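{- Let $G$ and $H$ be graphs. The Cartesian product $G\,\Box\,H$ is sequentially distance preserving if and only if both $G$ and $H$ are sequentially distance preserving.
   Context: All graphs are finite, undirected and simple, with nonempty vertex set (except that deleting all vertices of a graph gives the empty graph, which is vacuously an isometric subgraph). The distance $d_G(u,v)$ is the minimum length (number of edges) of a path from $u$ to $v$ in $G$, and $d_G(u,v)=\infty$ if no such path exists. A subgraph $K$ of $G$ is isometric, written $K\le G$, if $d_K(u,v)=d_G(u,v)$ for every pair of vertices $u,v\in V(K)$. For a set $A$ of vertices, $G-A$ is the graph obtained from $G$ by deleting the vertices in $A$ (and all incident edges). A graph $G$ with $n$ vertices is sequentially distance preserving (sdp) if it is connected and there is an ordering $u_1,\dots,u_n$ of its vertices such that $G-\{u_i\}_{i=1}^s\le G$ for all $1\le s\le n$. The Cartesian product $G\,\Box\,H$ is the graph with vertex set $V(G)\times V(H)$ and edge set $E(G\,\Box\,H)=\{(u,x)(v,y) : (uv\in E(G)\text{ and }x=y),\text{ or }(xy\in E(H)\text{ and }u=v)\}$. -}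

module Defs where

open import Data.Fin.Base using (Fin; toℕ)
open import Data.Fin.Properties using (any?; inj⇒≟; *↔×)
open import Data.List.Base using (List; []; _∷_)
open import Data.List.Relation.Unary.Unique.Propositional using (Unique)
open import Data.Nat.Base using (ℕ; zero; suc; _*_; _≤_; _<_; NonZero)
open import Data.Nat.Properties using (_<?_; m*n≢0)
open import Data.Product.Base using (Σ; ∃; ∃-syntax; _×_; _,_; proj₁)
open import Data.Product.Function.NonDependent.Propositional using (_×-↔_)
open import Data.Sum.Base using (_⊎_; inj₁; inj₂)
open import Function.Bundles using (_↔_; module Inverse)
open import Function.Construct.Composition using (_↔-∘_)
open import Function.Properties.Inverse using (↔⇒↣; ↔-sym)
open import Level using (0ℓ)
open import Relation.Binary.Construct.Closure.ReflexiveTransitive using (Star; ε; _◅_)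
open import Relation.Binary.Core using (Rel)
open import Relation.Binary.Definitions using (Symmetric; Irreflexive; DecidableEquality)
  renaming (Decidable to Decidable₂)
open import Relation.Binary.PropositionalEquality using (_≡_; refl; sym)
open import Relation.Nullary.Construct.Add.Supremum using (_⁺; ⊤⁺; [_])
open import Relation.Nullary.Decidable using (_×-dec_; _⊎-dec_; ¬?)
open import Relation.Nullary.Negation using (¬_)
open import Relation.Unary using (Pred; _∈_; _∉_; Decidable)

------------------------------------------------------------------------
-- Graphs

record Graph : Set₁ where
  field
    Vertex   : Set
    order    : ℕ
    vertices : Fin order ↔ Vertex
    nonEmpty : NonZero order
    Adj      : Rel Vertex 0ℓ
    adj?     : Decidable₂ Adj
    adj-sym  : Symmetric Adj
    loopless : Irreflexive _≡_ Adj

  _≟_ : DecidableEquality Vertex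
  _≟_ = inj⇒≟ (↔⇒↣ (↔-sym vertices))

open Graph using (Vertex; order; Adj)

-- A subgraph may be empty, unlike a graph.
record Subgraph (G : Graph) : Set₁ where
  field
    V        : Pred (Vertex G) 0ℓ
    E        : Rel (Vertex G) 0ℓ
    v?       : Decidable V
    e?       : Decidable₂ E
    e-sym    : Symmetric E
    e⊆adj    : ∀ {u v} → E u v → Adj G u v
    e-source : ∀ {u v} → E u v → u ∈ V

-- The induced subgraph G - A.
delete : (G : Graph) {A : Pred (Vertex G) 0ℓ} → Decidable A → Subgraph G
delete G {A} A? = record
  { V        = λ v → v ∉ A
  ; E        = λ u v → Adj G u v × u ∉ A × v ∉ A
  ; v?       = λ v → ¬? (A? v)
  ; e?       = λ u v → Graph.adj? G u v ×-dec ¬? (A? u) ×-dec ¬? (A? v)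
  ; e-sym    = λ (uv , u∉A , v∉A) → Graph.adj-sym G uv , v∉A , u∉A
  ; e⊆adj    = proj₁
  ; e-source = λ (_ , u∉A , _) → u∉A
  }

------------------------------------------------------------------------
-- Paths and distance

-- Everything here depends only on the edge relation E. The edges of a subgraph
-- have both ends in it, so a path in E that starts at a vertex of the
-- subgraph stays in the subgraph.
module _ {X : Set} (E : Rel X 0ℓ) where

  support : ∀ {u v} → Star E u v → List X
  support {u} ε       = u ∷ []
  support {u} (_ ◅ w) = u ∷ support w

  steps : ∀ {u v} → Star E u v → ℕ
  steps ε       = zero
  steps (_ ◅ w) = suc (steps w)

  Path : X → X → Set
  Path u v = Σ (Star E u v) λ w → Unique (support w)

  length : ∀ {u v} → Path u v → ℕ
  length (w , _) = steps w

  -- IsDistance u v d says that d(u,v) = d, where ⊤⁺ plays the role of ∞.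
  IsDistance : X → X → ℕ ⁺ → Set
  IsDistance u v [ d ] = (∃[ p ] length {u} {v} p ≡ d) × (∀ (p : Path u v) → d ≤ length p)
  IsDistance u v ⊤⁺    = ¬ Path u v

Connected : Graph → Set
Connected G = ∀ u v → Path (Adj G) u v

Isometric : (G : Graph) → Subgraph G → Set
Isometric G K = ∀ {u v} → u ∈ V → v ∈ V →
  ∃[ d ] IsDistance E u v d × IsDistance (Adj G) u v d
  where open Subgraph K

------------------------------------------------------------------------
-- Sequentially distance preserving graphs

-- With u₁,…,uₙ given by σ (indexed from 0), the set {u₁,…,uₛ}.
Initial : ∀ {n} {X : Set} → Fin n ↔ X → ℕ → Pred X 0ℓ
Initial σ s v = ∃[ i ] toℕ i < s × Inverse.to σ i ≡ v

initial? : ∀ (G : Graph) {n} (σ : Fin n ↔ Vertex G) s → Decidable (Initial σ s)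
initial? G σ s v = any? λ i → (toℕ i <? s) ×-dec (Graph._≟_ G (Inverse.to σ i) v)

SDP : Graph → Set
SDP G = Connected G ×
  (∃ λ (σ : Fin (order G) ↔ Vertex G) →
     ∀ s → 1 ≤ s → s ≤ order G → Isometric G (delete G (initial? G σ s)))

------------------------------------------------------------------------
-- The Cartesian product

infixr 7 _□_

_□_ : Graph → Graph → Graph
G □ H = record
  { Vertex   = G.Vertex × H.Vertex
  ; order    = G.order * H.order
  ; vertices = (G.vertices ×-↔ H.vertices) ↔-∘ *↔×
  ; nonEmpty = m*n≢0 G.order H.order {{G.nonEmpty}} {{H.nonEmpty}}
  ; Adj      = λ (u , x) (v , y) → (G.Adj u v × x ≡ y) ⊎ (H.Adj x y × u ≡ v)
  ; adj?     = λ (u , x) (v , y) → (G.adj? u v ×-dec (x H.≟ y)) ⊎-dec (H.adj? x y ×-dec (u G.≟ v))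
  ; adj-sym  = λ { (inj₁ (uv , x≡y)) → inj₁ (G.adj-sym uv , sym x≡y)
                 ; (inj₂ (xy , u≡v)) → inj₂ (H.adj-sym xy , sym u≡v) }
  ; loopless = λ { refl (inj₁ (uu , _)) → G.loopless refl uu
                 ; refl (inj₂ (xx , _)) → H.loopless refl xx }
  }
  where
  module G = Graph G
  module H = Graph H

{-# OPTIONS --safe #-}
module Submission where

-- A deletion order is recorded by a key on the vertices, and it is distance
-- preserving as soon as every walk from u to a later vertex v can be replaced
-- by one that is no longer and never visits a vertex earlier than u.
-- Lexicographic keys on G □ H work: first move in G along vertices that are
-- not deleted before the current one, then freely in the last fibre.
-- Conversely, delete g from G when the last vertex of its fibre is deleted from
-- G □ H. A product walk splits into its two projections, so a short walk
-- between two fibre maxima, compared with a geodesic in H, projects to a short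
-- walk in G.

open import Defs
open import Data.Fin.Base as Fin using (Fin; toℕ; cast; fromℕ<)
open import Data.Fin.Permutation using (Permutation′; _⟨$⟩ʳ_; _∘ₚ_; cast-id)
open import Data.Fin.Properties using (any?; toℕ-injective; toℕ-cast; cast-involutive; toℕ<n)
open import Data.List.Base using (tabulate; lookup)
import Data.List.Extrema as Extrema
open import Data.List.Membership.Propositional.Properties using (∈-tabulate⁺)
open import Data.List.Properties using (length-tabulate; lookup-tabulate)
open import Data.List.Relation.Binary.Permutation.Propositional using (↭⇒↭ₛ)
open import Data.List.Relation.Binary.Permutation.Propositional.Properties using (↭-length)
import Data.List.Relation.Binary.Permutation.Homogeneous as Homogeneous
import Data.List.Relation.Binary.Permutation.Setoid.Properties as Permutation
open import Data.List.Relation.Unary.All as All using ()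
open import Data.List.Relation.Unary.All.Properties using (¬Any⇒All¬)
open import Data.List.Relation.Unary.AllPairs using ([]; _∷_)
open import Data.List.Relation.Unary.Any using (here; there)
open import Data.List.Membership.Propositional using (_∈_)
import Data.List.Membership.DecPropositional as DecMembership
import Data.List.Sort as Sort
open import Data.List.Relation.Unary.Sorted.TotalOrder.Properties using (lookup-mono-≤)
open import Data.List.Relation.Unary.Unique.Propositional using (Unique)
open import Data.Nat.Base using (ℕ; zero; suc; _+_; _≤_; z≤n; s≤s; s≤s⁻¹; >-nonZero⁻¹)
open import Data.Nat.Properties
  using (≤-refl; ≤-reflexive; ≤-trans; ≤-antisym; <⇒≤; <⇒≱; ≮⇒≥; ≰⇒>; m≤n⇒m≤1+n; m≤n+m;
         +-monoʳ-≤; +-cancelʳ-≤; +-comm; +-suc; ≤-decTotalOrder)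
open import Data.Product.Base using (Σ; ∃-syntax; _×_; _,_; proj₁; proj₂; swap)
open import Data.Product.Relation.Binary.Lex.NonStrict using (×-decTotalOrder)
open import Data.Sum.Base as Sum using (_⊎_; inj₁; inj₂)
open import Function.Base using (_∘_; id)
open import Function.Bundles using (_⇔_; _↔_; mk⇔; module Inverse)
open import Function.Construct.Composition using (_↔-∘_)
open import Level using (0ℓ)
open import Relation.Binary.Bundles using (DecTotalOrder)
open import Relation.Binary.Construct.Closure.ReflexiveTransitive using (Star; ε; _◅_; _◅◅_; gmap)
open import Relation.Binary.Core using (Rel)
open import Relation.Binary.Definitions using (DecidableEquality; Symmetric)
open import Relation.Binary.PropositionalEquality using (_≡_; refl; sym; trans; cong; cong₂; subst; subst₂; setoid)
open import Relation.Nullary.Construct.Add.Supremum using ([_]; ⊤⁺)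
open import Relation.Nullary.Decidable using (Dec; yes; no; map′; _×-dec_; _⊎-dec_)
open import Relation.Nullary.Negation using (contradiction)
open import Relation.Unary using (Pred; _∉_)

open Graph using (Vertex; order; vertices; nonEmpty; Adj; adj?; adj-sym)

-- Walks of bounded length

-- Bounded walks stand in for distances: they concatenate and project without care for repeated
-- vertices, and having one says d(u,v) ≤ n with no case for infinity.
Within : {X : Set} → Rel X 0ℓ → ℕ → Rel X 0ℓ
Within E n u v = Σ (Star E u v) λ w → steps E w ≤ n

Induced : {X : Set} → Rel X 0ℓ → Pred X 0ℓ → Rel X 0ℓ
Induced E P u v = E u v × P u × P v

module _ {X Y : Set} {E : Rel X 0ℓ} {F : Rel Y 0ℓ} (f : X → Y)
         (g : ∀ {u v} → E u v → F (f u) (f v)) where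

  steps-gmap : ∀ {u v} (w : Star E u v) → steps F (gmap f g w) ≡ steps E w
  steps-gmap ε       = refl
  steps-gmap (_ ◅ w) = cong suc (steps-gmap w)

  within-gmap : ∀ {n u v} → Within E n u v → Within F n (f u) (f v)
  within-gmap (w , w≤n) = gmap f g w , ≤-trans (≤-reflexive (steps-gmap w)) w≤n

module _ {X : Set} {E : Rel X 0ℓ} where

  within-refl : ∀ {u} → Within E 0 u u
  within-refl = ε , z≤n

  within-step : ∀ {n u v x} → E u v → Within E n v x → Within E (suc n) u x
  within-step e (w , w≤n) = e ◅ w , s≤s w≤n

  within-mono : ∀ {m n u v} → m ≤ n → Within E m u v → Within E n u v
  within-mono m≤n (w , w≤m) = w , ≤-trans w≤m m≤n

  within-trans : ∀ {m n u v x} → Within E m u v → Within E n v x → Within E (m + n) u x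
  within-trans {n = n} (ε , _) q = within-mono (m≤n+m n _) q
  within-trans {suc m} (e ◅ w , w≤m) q = within-step e (within-trans (w , s≤s⁻¹ w≤m) q)

  within-sym : Symmetric E → ∀ {n u v} → Within E n u v → Within E n v u
  within-sym E-sym (ε , _) = ε , z≤n
  within-sym E-sym {suc n} (e ◅ w , w≤n) =
    within-mono (≤-reflexive (+-comm n 1))
      (within-trans (within-sym E-sym (w , s≤s⁻¹ w≤n)) (E-sym e ◅ ε , ≤-refl))

  path⇒within : ∀ {u v} (p : Path E u v) → Within E (length E p) u v
  path⇒within (w , _) = w , ≤-refl

-- Extracting paths from walks

module _ {X : Set} (_≟_ : DecidableEquality X) {E : Rel X 0ℓ} where

  open DecMembership _≟_ using (_∈?_)

  suffix : ∀ {u x v} (w : Star E x v) → Unique (support E w) → u ∈ support E w →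
           ∃[ p ] length E {u} {v} p ≤ steps E w
  suffix ε       unique       (here refl) = (ε , unique) , z≤n
  suffix (e ◅ w) unique       (here refl) = (e ◅ w , unique) , ≤-refl
  suffix (e ◅ w) (_ ∷ unique) (there u∈w) with suffix w unique u∈w
  ... | p , p≤w = p , m≤n⇒m≤1+n p≤w

  -- Loop erasure: the tail is made a path first, and if it meets `u` again it is cut back to its
  -- suffix from `u`.
  walk⇒path : ∀ {u v} (w : Star E u v) → ∃[ p ] length E {u} {v} p ≤ steps E w
  walk⇒path ε = (ε , All.[] ∷ []) , z≤n
  walk⇒path {u} (e ◅ w) with walk⇒path w
  ... | (w′ , unique) , w′≤w with u ∈? support E w′
  ...   | yes u∈w′ with suffix w′ unique u∈w′
  ...     | p , p≤w′ = p , m≤n⇒m≤1+n (≤-trans p≤w′ w′≤w)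
  walk⇒path {u} (e ◅ w) | (w′ , unique) , w′≤w | no u∉w′ =
    (e ◅ w′ , ¬Any⇒All¬ _ u∉w′ ∷ unique) , s≤s w′≤w

  within⇒path : ∀ {n u v} → Within E n u v → ∃[ p ] length E {u} {v} p ≤ n
  within⇒path (w , w≤n) with walk⇒path w
  ... | p , p≤w = p , ≤-trans p≤w w≤n

-- Distances and isometric subgraphs

module _ (G : Graph) where

  private
    module V = Inverse (vertices G)

  -- Finiteness makes the search for a first step decidable; `geodesic` relies on this to find a
  -- least length constructively.
  within? : ∀ n u v → Dec (Within (Adj G) n u v)
  within? zero    u v = map′ (λ { refl → within-refl }) (λ { (ε , _) → refl }) (Graph._≟_ G u v)
  within? (suc n) u v =
    map′ (λ { (inj₁ refl) → ε , z≤n ; (inj₂ (_ , e , w)) → within-step e w })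
         (λ { (ε , _) → inj₁ refl
            ; (_◅_ {j = x} e w , w≤n) → inj₂
                ( V.from x
                , subst (Adj G u) (sym (V.strictlyInverseˡ x)) e
                , subst (λ y → Within (Adj G) n y v) (sym (V.strictlyInverseˡ x)) (w , s≤s⁻¹ w≤n)) })
         (Graph._≟_ G u v ⊎-dec any? λ i → adj? G u (V.to i) ×-dec within? n (V.to i) v)

  geodesic : ∀ {n u v} → Within (Adj G) n u v →
             ∃[ d ] Within (Adj G) d u v × (∀ {k} → Within (Adj G) k u v → d ≤ k)
  geodesic {zero} w = 0 , w , λ _ → z≤n
  geodesic {suc n} {u} {v} w with within? n u v
  ... | yes w′ = geodesic w′
  ... | no ¬w′ = suc n , w , λ w″ → ≰⇒> λ k≤n → ¬w′ (within-mono k≤n w″)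

  module _ (K : Subgraph G) where
    open Subgraph K

    -- The common distance is finite because the given walk contains a path, so some path in `K`
    -- realises it and no path in `G` is shorter.
    isometric⇒within : Isometric G K → ∀ {n u v} → V u → V v →
                       Within (Adj G) n u v → Within E n u v
    isometric⇒within iso u∈V v∈V w with iso u∈V v∈V | within⇒path (Graph._≟_ G) w
    ... | ⊤⁺    , _ , ¬path                      | p , _   = contradiction p ¬path
    ... | [ d ] , ((q , q≡d) , _) , (_ , d≤path) | p , p≤n =
      within-mono (≤-trans (≤-reflexive q≡d) (≤-trans (d≤path p) p≤n)) (path⇒within q)

    -- Connectedness gives a geodesic of `G`, which `shorten` moves into `K` without lengthening it.
    -- Walks in `K` are walks in `G`, so none is shorter.
    within⇒isometric : (∀ u v → Star (Adj G) u v) →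
                       (∀ {n u v} → V u → V v → Within (Adj G) n u v → Within E n u v) →
                       Isometric G K
    within⇒isometric connected shorten {u} {v} u∈V v∈V
      with geodesic (connected u v , ≤-refl)
    ... | d , w , minimal
      with within⇒path (Graph._≟_ G) w | within⇒path (Graph._≟_ G) (shorten u∈V v∈V w)
    ... | p , p≤d | q , q≤d =
      [ d ] , ((q , ≤-antisym q≤d (E-minimal q)) , E-minimal)
            , ((p , ≤-antisym p≤d (G-minimal p)) , G-minimal)
      where
      G-minimal : ∀ r → d ≤ length (Adj G) r
      G-minimal r = minimal (path⇒within r)
      E-minimal : ∀ r → d ≤ length E r
      E-minimal r = minimal (within-gmap id e⊆adj (path⇒within r))

-- Deletion orders

-- Keys may lie in any decidable total order, so lexicographic pairs serve without renumbering. Only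
-- the case of `u` before `v` is required; the other follows by reversing walks.
record EliminationOrder (G : Graph) : Set₁ where
  field
    decTotalOrder : DecTotalOrder 0ℓ 0ℓ 0ℓ
  open DecTotalOrder decTotalOrder public
    using (totalOrder; _≈_; Carrier; antisym; total; module Eq)
    renaming (_≤_ to _≼_; refl to ≼-refl; trans to ≼-trans)
  field
    key           : Vertex G → Carrier
    key-injective : ∀ {u v} → key u ≈ key v → u ≡ v
    shortcut      : ∀ {n u v} → key u ≼ key v → Within (Adj G) n u v →
                    Within (Induced (Adj G) λ w → key u ≼ key w) n u v

module _ {n} {X : Set} (σ : Fin n ↔ X) where
  open Inverse σ

  remaining⁺ : ∀ {s v} → s ≤ toℕ (from v) → v ∉ Initial σ s
  remaining⁺ s≤v (i , i<s , refl) =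
    <⇒≱ i<s (subst (λ j → _ ≤ toℕ j) (strictlyInverseʳ i) s≤v)

  remaining⁻ : ∀ {s v} → v ∉ Initial σ s → s ≤ toℕ (from v)
  remaining⁻ v∉ = ≮⇒≥ λ v<s → v∉ (from _ , v<s , strictlyInverseˡ _)

SDP⇒eliminationOrder : ∀ G → SDP G → EliminationOrder G
SDP⇒eliminationOrder G (_ , σ , isometric) = record
  { decTotalOrder = ≤-decTotalOrder
  ; key           = position
  ; key-injective = λ u≡v → trans (sym (strictlyInverseˡ _))
                              (trans (cong to (toℕ-injective u≡v)) (strictlyInverseˡ _))
  -- Here `s` is the position of `u`, counted from 0: exactly the vertices before `u` are deleted,
  -- and `u` survives.
  ; shortcut      = shortcut′ _ (<⇒≤ (toℕ<n (from _))) ≤-refl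
  }
  where
  open Inverse σ
  position : Vertex G → ℕ
  position v = toℕ (from v)
  shortcut′ : ∀ s → s ≤ order G → ∀ {n u v} → s ≤ position u → s ≤ position v →
              Within (Adj G) n u v → Within (Induced (Adj G) λ w → s ≤ position w) n u v
  -- `SDP` speaks only of s ≥ 1; with nothing deleted the walk itself serves.
  shortcut′ zero    _   _   _   w = within-gmap id (λ e → e , z≤n , z≤n) w
  shortcut′ (suc s) s≤n s≤u s≤v w =
    within-gmap id (λ (e , u∉ , v∉) → e , remaining⁻ σ u∉ , remaining⁻ σ v∉)
      (isometric⇒within G (delete G (initial? G σ (suc s))) (isometric (suc s) (s≤s z≤n) s≤n)
        (remaining⁺ σ s≤u) (remaining⁺ σ s≤v) w)

-- Sorting vertices by key

module _ (O : DecTotalOrder 0ℓ 0ℓ 0ℓ) where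
  open DecTotalOrder O using (Carrier; totalOrder) renaming (_≤_ to _≼_)
  open Sort O using (sort; sort-↭; sort-↗)

  sortingPermutation : ∀ {n} (f : Fin n → Carrier) →
    Σ (Permutation′ n) λ π → ∀ {i j} → i Fin.≤ j → f (π ⟨$⟩ʳ i) ≼ f (π ⟨$⟩ʳ j)
  sortingPermutation {n} f = π , λ {i} {j} i≤j →
    subst₂ _≼_ (lookup-sorted i) (lookup-sorted j)
      (lookup-mono-≤ totalOrder (sort-↗ xs)
        (subst₂ _≤_ (sym (toℕ-cast n≡sorted i)) (sym (toℕ-cast n≡sorted j)) i≤j))
    where
    xs = tabulate f
    sorted↭ = ↭⇒↭ₛ (sort-↭ xs)
    n≡sorted = trans (sym (length-tabulate f)) (sym (↭-length (sort-↭ xs)))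
    -- Read from left to right: a rank, a position in the sorted list, a position in `xs`, an
    -- argument of `f`.
    π = cast-id n≡sorted ∘ₚ Homogeneous.onIndices sorted↭ ∘ₚ cast-id (length-tabulate f)
    lookup-xs : ∀ i → lookup xs i ≡ f (cast (length-tabulate f) i)
    lookup-xs i = trans
      (cong (lookup xs) (sym (cast-involutive (sym (length-tabulate f)) (length-tabulate f) i)))
      (lookup-tabulate f (cast (length-tabulate f) i))
    lookup-sorted : ∀ i → lookup (sort xs) (cast n≡sorted i) ≡ f (π ⟨$⟩ʳ i)
    lookup-sorted i =
      trans (Permutation.onIndices-lookup (setoid Carrier) sorted↭ (cast n≡sorted i)) (lookup-xs _)

eliminationOrder⇒SDP : ∀ G → (∀ u v → Star (Adj G) u v) → EliminationOrder G → SDP G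
eliminationOrder⇒SDP G connected elimination =
  (λ u v → proj₁ (walk⇒path (Graph._≟_ G) (connected u v))) ,
  σ ,
  λ s _ _ → within⇒isometric G (delete G (initial? G σ s)) connected (shorten s)
  where
  open EliminationOrder elimination
  π-sorted = sortingPermutation decTotalOrder (key ∘ Inverse.to (vertices G))
  σ = vertices G ↔-∘ proj₁ π-sorted
  open Inverse σ

  to-mono : ∀ {i j} → i Fin.≤ j → key (to i) ≼ key (to j)
  to-mono = proj₂ π-sorted

  -- Sorting alone permits ties in any order. If `v` came strictly before `u`, antisymmetry and
  -- injectivity of the key would identify them.
  from-mono : ∀ {u v} → key u ≼ key v → from u Fin.≤ from v
  from-mono {u} {v} u≼v = ≮⇒≥ λ v<u → <⇒≱ v<u (≤-reflexive (cong (toℕ ∘ from) (key-injective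
    (antisym u≼v (subst₂ (λ x y → key x ≼ key y) (strictlyInverseˡ v) (strictlyInverseˡ u)
      (to-mono (<⇒≤ v<u)))))))

  -- Everything on the shortcut is no earlier than `u`, which survives, so the first `s` deletions
  -- miss the whole walk.
  shorten-≼ : ∀ s {n u v} → u ∉ Initial σ s → key u ≼ key v → Within (Adj G) n u v →
              Within (Subgraph.E (delete G (initial? G σ s))) n u v
  shorten-≼ s {u = u} u∉ u≼v w = within-gmap id (λ (e , x , y) → e , stays x , stays y) (shortcut u≼v w)
    where
    stays : ∀ {x} → key u ≼ key x → x ∉ Initial σ s
    stays u≼x = remaining⁺ σ (≤-trans (remaining⁻ σ u∉) (from-mono u≼x))

  shorten : ∀ s {n u v} → u ∉ Initial σ s → v ∉ Initial σ s → Within (Adj G) n u v →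
            Within (Subgraph.E (delete G (initial? G σ s))) n u v
  shorten s {u = u} {v} u∉ v∉ w with total (key u) (key v)
  ... | inj₁ u≼v = shorten-≼ s u∉ u≼v w
  ... | inj₂ v≼u = within-sym (Subgraph.e-sym (delete G (initial? G σ s)))
                     (shorten-≼ s v∉ v≼u (within-sym (adj-sym G) w))

-- Cartesian products

module _ {X Y : Set} {E : Rel (X × Y) 0ℓ} {F : Rel X 0ℓ} {F′ : Rel Y 0ℓ}
         (split : ∀ {g g′ x x′} → E (g , x) (g′ , x′) → (F g g′ × x ≡ x′) ⊎ (F′ x x′ × g ≡ g′)) where

  -- Each edge is charged to exactly one factor, so the lengths of the projections add. `E` is
  -- general because the walk may run in a restricted part of the product, whose trace `F` can
  -- record.
  within-split : ∀ {n g g′ x x′} → Within E n (g , x) (g′ , x′) →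
                 ∃[ a ] ∃[ b ] Within F a g g′ × Within F′ b x x′ × a + b ≤ n
  within-split (ε , _) = 0 , 0 , within-refl , within-refl , z≤n
  within-split {suc n} (e ◅ w , w≤n) with split e | within-split (w , s≤s⁻¹ w≤n)
  ... | inj₁ (f , refl) | a , b , p , q , a+b≤n = suc a , b , within-step f p , q , s≤s a+b≤n
  ... | inj₂ (f , refl) | a , b , p , q , a+b≤n =
    a , suc b , p , within-step f q , ≤-trans (≤-reflexive (+-suc a b)) (s≤s a+b≤n)

-- Exists because graphs are nonempty; it selects the fibre whose walks are projected to prove a
-- factor connected.
root : ∀ G → Vertex G
root G = Inverse.to (vertices G) (fromℕ< (>-nonZero⁻¹ (order G) {{nonEmpty G}}))

module _ (G H : Graph) where

  □-eliminationOrder : EliminationOrder G → EliminationOrder H → EliminationOrder (G □ H)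
  □-eliminationOrder 𝓖 𝓗 = record
    { decTotalOrder = lex
    ; key           = key
    ; key-injective = λ (g≈g′ , x≈x′) → cong₂ _,_ (𝓖.key-injective g≈g′) (𝓗.key-injective x≈x′)
    ; shortcut      = shortcut
    }
    where
    module 𝓖 = EliminationOrder 𝓖
    module 𝓗 = EliminationOrder 𝓗
    lex = ×-decTotalOrder 𝓖.decTotalOrder 𝓗.decTotalOrder
    open DecTotalOrder lex using () renaming (_≤_ to _≼_; Carrier to Key)

    key : Vertex G × Vertex H → Key
    key (g , x) = 𝓖.key g , 𝓗.key x

    weaken : ∀ {u v : Vertex G} {x : Vertex H} → 𝓖.key u 𝓖.≼ 𝓖.key v → key (u , x) ≼ key (v , x)
    weaken {u} {v} u≼v with DecTotalOrder._≟_ 𝓖.decTotalOrder (𝓖.key u) (𝓖.key v)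
    ... | yes u≈v = inj₂ (u≈v , 𝓗.≼-refl)
    ... | no  u≉v = inj₁ (u≼v , u≉v)

    shortcut : ∀ {n u v} → key u ≼ key v → Within (Adj (G □ H)) n u v →
               Within (Induced (Adj (G □ H)) λ w → key u ≼ key w) n u v
    shortcut {u = g , x} {g′ , x′} u≼v w with within-split {F = Adj G} {F′ = Adj H} id w
    -- The order of the two moves matters: an H-step inside the fibre of `g` could reach a vertex
    -- before `x`, but the whole fibre of `g′` is strictly later.
    shortcut {u = g , x} {g′ , x′} (inj₁ g≺g′) w | a , b , p , q , a+b≤n = within-mono a+b≤n
      (within-trans
        (within-gmap (_, x) (λ (e , h , h′) → inj₁ (e , refl) , weaken h , weaken h′)
          (𝓖.shortcut (proj₁ g≺g′) p))
        (within-gmap (g′ ,_) (λ e → inj₂ (e , refl) , inj₁ g≺g′ , inj₁ g≺g′) q))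
    -- Both ends lie in one fibre, so the G-projection is dropped and only the H-projection is
    -- rerouted.
    shortcut {u = g , x} {g′ , x′} (inj₂ (g≈g′ , x≼x′)) w | a , b , p , q , a+b≤n
      with refl ← 𝓖.key-injective g≈g′ =
      within-mono (≤-trans (m≤n+m b a) a+b≤n)
        (within-gmap (g ,_)
          (λ (e , h , h′) → inj₂ (e , refl) , inj₂ (𝓖.Eq.refl , h) , inj₂ (𝓖.Eq.refl , h′))
          (𝓗.shortcut x≼x′ q))

  □-connected : (∀ u v → Star (Adj G) u v) → (∀ x y → Star (Adj H) x y) →
                ∀ u v → Star (Adj (G □ H)) u v
  □-connected connG connH (g , x) (g′ , x′) =
    gmap (_, x) (λ e → inj₁ (e , refl)) (connG g g′) ◅◅
    gmap (g′ ,_) (λ e → inj₂ (e , refl)) (connH x x′)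

  □-swap-adj : ∀ {u v} → Adj (G □ H) u v → Adj (H □ G) (swap u) (swap v)
  □-swap-adj = Sum.swap

  -- Factors of a product

  module _ (connected : ∀ u v → Star (Adj (G □ H)) u v) where

    □-connectedˡ : ∀ g g′ → Star (Adj G) g g′
    □-connectedˡ g g′
      with _ , _ , (w , _) , _ ← within-split {F = Adj G} {F′ = Adj H} id
                                   (connected (g , root H) (g′ , root H) , ≤-refl) = w

    □-connectedʳ : ∀ x x′ → Star (Adj H) x x′
    □-connectedʳ x x′
      with _ , _ , _ , (w , _) , _ ← within-split {F = Adj G} {F′ = Adj H} id
                                       (connected (root G , x) (root G , x′) , ≤-refl) = w

    □-eliminationOrderˡ : EliminationOrder (G □ H) → EliminationOrder G
    □-eliminationOrderˡ elimination = record
      { decTotalOrder = 𝓔.decTotalOrder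
      ; key           = key
      ; key-injective = λ g≈g′ → cong proj₁ (𝓔.key-injective g≈g′)
      ; shortcut      = shortcut
      }
      where
      module 𝓔 = EliminationOrder elimination
      open 𝓔 using (_≼_; Carrier)
      open Extrema 𝓔.totalOrder using (argmax; f[xs]≤f[argmax])
      xs = tabulate (Inverse.to (vertices H))

      top : Vertex G → Vertex H
      top g = argmax (λ x → 𝓔.key (g , x)) (root H) xs

      key : Vertex G → Carrier
      key g = 𝓔.key (g , top g)

      top-max : ∀ g x → 𝓔.key (g , x) ≼ key g
      top-max g x = All.lookup (f[xs]≤f[argmax] (root H) xs)
        (subst (_∈ xs) (Inverse.strictlyInverseˡ (vertices H) x) (∈-tabulate⁺ (Inverse.from (vertices H) x)))

      shortcut : ∀ {n u v} → key u ≼ key v → Within (Adj G) n u v →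
                 Within (Induced (Adj G) λ w → key u ≼ key w) n u v
      shortcut {n} {g} {g′} g≼g′ p
        -- A geodesic is essential: its length `d` must bound from below the H-part of whatever walk
        -- the product shortcut returns.
        with d , q , minimal ← geodesic H (□-connectedʳ (top g) (top g′) , ≤-refl)
        with a , b , p′ , q′ , a+b≤n+d ← within-split {F = Induced (Adj G) λ w → key g ≼ key w} {F′ = Adj H}
               (λ where
                 (inj₁ (e , refl) , h , h′) →
                   -- A visited vertex is no earlier than `(g , top g)`, and the maximum of its
                   -- fibre is no earlier than it.
                   inj₁ ((e , 𝓔.≼-trans h (top-max _ _) , 𝓔.≼-trans h′ (top-max _ _)) , refl)
                 (inj₂ e , _) → inj₂ e)
               (𝓔.shortcut g≼g′ (within-trans
                 (within-gmap (_, top g) (λ e → inj₁ (e , refl)) p)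
                 (within-gmap (g′ ,_) (λ e → inj₂ (e , refl)) q)))
        -- From a + b ≤ n + d and d ≤ b, cancelling d gives a ≤ n.
        = within-mono (+-cancelʳ-≤ d a n (≤-trans (+-monoʳ-≤ a (minimal q′)) a+b≤n+d)) p′

-- Lets the argument for the left factor serve for the right one.
□-swap-eliminationOrder : ∀ G H → EliminationOrder (G □ H) → EliminationOrder (H □ G)
□-swap-eliminationOrder G H elimination = record
  { decTotalOrder = decTotalOrder
  ; key           = key ∘ swap
  ; key-injective = λ u≈v → cong swap (key-injective u≈v)
  ; shortcut      = λ u≼v w →
      within-gmap swap (λ (e , h , h′) → □-swap-adj G H e , h , h′)
        (shortcut u≼v (within-gmap swap (□-swap-adj H G) w))
  }
  where open EliminationOrder elimination

theorem4p4 : (G H : Graph) → SDP (G □ H) ⇔ (SDP G × SDP H)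
theorem4p4 G H = mk⇔
  (λ sdp →
    let connected   = λ u v → proj₁ (proj₁ sdp u v)
        connected′  = λ u v → gmap swap (□-swap-adj G H) (connected (swap u) (swap v))
        elimination = SDP⇒eliminationOrder (G □ H) sdp
    in eliminationOrder⇒SDP G (□-connectedˡ G H connected) (□-eliminationOrderˡ G H connected elimination)
     , eliminationOrder⇒SDP H (□-connectedʳ G H connected)
         (□-eliminationOrderˡ H G connected′ (□-swap-eliminationOrder G H elimination)))
  (λ (sdpG , sdpH) → eliminationOrder⇒SDP (G □ H)
    (□-connected G H (λ u v → proj₁ (proj₁ sdpG u v)) (λ u v → proj₁ (proj₁ sdpH u v)))
    (□-eliminationOrder G H (SDP⇒eliminationOrder G sdpG) (SDP⇒eliminationOrder H sdpH)))
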